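{- For a tripos $\mathcal{P}$ the following are equivalent: (i) $\mathcal{P}$ is equivalent to the relative realizability tripos over some relative PCA; (ii) $\mathcal{P}$ has enough $\exists$-prime predicates, and the indexed sub-preorder $\mathsf{prim}(\mathcal{P})$ of $\exists$-prime predicates has finite meets (in each fiber, preserved by reindexing) and a discrete generic predicate.
   Context: An indexed preorder is a pseudofunctor $\mathcal{P}:\mathsf{Set}^{op}\to\mathsf{Ord}$, $u^*=\mathcal{P}(u)$; equivalence is in the locally ordered category of indexed preorders and pseudonatural transformations. A generic predicate is some $\iota\in\mathcal{P}(C)$ with every $\varphi\in\mathcal{P}(B)$ isomorphic to $f^*\iota$ for some $f:B\to C$. A tripos is an indexed preorder whose fibers are Heyting preorders (finite meets and implication right adjoint to $-\wedge a$), preserved by reindexing, in which every $u^*$ has a right adjoint $\forall_u$ satisfying Beck–Chevalley for pullbacks in $\mathsf{Set}$, and which has a generic predicate; a tripos also has existential quantification, i.e. left adjoints $\exists_u\dashv u^*$ satisfying Beck–Chevalley. A predicate $\pi\in\mathcal{P}(I)$ is $\exists$-prime if for all $I\xleftarrow{u}J\xleftarrow{v}K$ and $\varphi\in\mathcal{P}(K)$ with $u^*\pi\le\exists_v\varphi$ there is $s:J\to K$ with $v\circ s=\mathrm{id}_J$ and $u^*\pi\le s^*\varphi$; $\mathcal{P}$ has enough $\exists$-primes if every predicate is isomorphic to $\exists_u\pi$ for some $\exists$-prime $\pi$. A predicate $\delta\in\mathcal{A}(I)$ is discrete if for every surjection $e:K\to J$, function $f:K\to I$ and $\varphi\in\mathcal{A}(J)$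 with $e^*\varphi\le f^*\delta$, there is $g:J\to I$ with $g\circ e=f$. A relative PCA is a triple $(A,\cdot,A_\#)$ where $\cdot:A\times A\rightharpoonup A$ is a partial binary operation (application, associating to the left) and $A_\#\subseteq A$ is closed under application whenever defined and contains elements $\mathsf{k},\mathsf{s}$ with, for all $a,b,c\in A$: $\mathsf{k}\cdot a\cdot b$ defined and equal to $a$; $\mathsf{s}\cdot a\cdot b$ defined; $\mathsf{s}\cdot a\cdot b\cdot c$ defined if and only if $a\cdot c\cdot(b\cdot c)$ is defined, in which case they are equal. Its relative realizability tripos is the indexed preorder $I\mapsto((PA)^I,\le)$, reindexing by precomposition, where $\varphi\le\psi$ iff there exists $e\in A_\#$ such that for all $i\in I$ and $a\in\varphi(i)$, $e\cdot a$ is defined and $e\cdot a\in\psi(i)$. -}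

module Defs where

open import Level using (Level; _⊔_) renaming (suc to lsuc)
open import Data.Bool.Base using (Bool; T)
open import Data.Maybe.Base using (Maybe; just; nothing; _>>=_)
open import Data.Product.Base using (Σ; Σ-syntax; _×_; _,_; proj₁; proj₂)
open import Function.Base using (id; _∘_)
open import Function.Bundles using (_⇔_; mk⇔; Equivalence)
open import Function.Definitions using (StrictlySurjective)
open import Relation.Binary.Core using (Rel)
open import Relation.Binary.Definitions using (Maximum)
open import Relation.Binary.Lattice.Definitions using (Infimum; Exponential)
open import Relation.Binary.PropositionalEquality using (_≡_; refl; sym; trans; cong; cong₂; _≗_; isEquivalence)
open import Relation.Binary.Structures using (IsPreorder)

private
  variable
    ℓ o o′ r r′ : Level

-- The base category has the types in Set ℓ as objects and functions as
-- morphisms; morphisms are compared by pointwise equality _≗_.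

record IsPullback {X I J K : Set ℓ} (p : X → I) (q : X → J) (u : I → K) (v : J → K) : Set (lsuc ℓ) where
  field
    commutes  : u ∘ p ≗ v ∘ q
    universal : {Y : Set ℓ} (f : Y → I) (g : Y → J) → u ∘ f ≗ v ∘ g →
                Σ[ h ∈ (Y → X) ] (p ∘ h ≗ f) × (q ∘ h ≗ g) ×
                  (∀ h′ → p ∘ h′ ≗ f → q ∘ h′ ≗ g → h′ ≗ h)

-- The coherence conditions of a pseudofunctor into Ord are automatic.
-- ^*-cong says that reindexing is well defined on morphisms, which are
-- functions up to _≗_.

record IndexedPreorder (ℓ o r : Level) : Set (lsuc (ℓ ⊔ o ⊔ r)) where
  infix  4 _≤_ _≅_
  infixr 8 _^*_
  field
    Pred       : Set ℓ → Set o
    _≤_        : {I : Set ℓ} → Rel (Pred I) r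
    isPreorder : {I : Set ℓ} → IsPreorder _≡_ (_≤_ {I})
    _^*_       : {I J : Set ℓ} → (I → J) → Pred J → Pred I

  _≅_ : {I : Set ℓ} → Rel (Pred I) r
  φ ≅ ψ = (φ ≤ ψ) × (ψ ≤ φ)

  field
    ^*-mono : {I J : Set ℓ} (u : I → J) {φ ψ : Pred J} → φ ≤ ψ → u ^* φ ≤ u ^* ψ
    ^*-cong : {I J : Set ℓ} {u v : I → J} → u ≗ v → (φ : Pred J) → u ^* φ ≅ v ^* φ
    ^*-id   : {I : Set ℓ} (φ : Pred I) → id ^* φ ≅ φ
    ^*-∘    : {I J K : Set ℓ} (u : I → J) (v : J → K) (φ : Pred K) → (v ∘ u) ^* φ ≅ u ^* v ^* φ

  ≤-refl : {I : Set ℓ} {φ : Pred I} → φ ≤ φ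
  ≤-refl = IsPreorder.refl isPreorder

  ≤-trans : {I : Set ℓ} {φ ψ χ : Pred I} → φ ≤ ψ → ψ ≤ χ → φ ≤ χ
  ≤-trans = IsPreorder.trans isPreorder

record PseudonaturalTransformation (P : IndexedPreorder ℓ o r) (Q : IndexedPreorder ℓ o′ r′)
       : Set (lsuc ℓ ⊔ o ⊔ r ⊔ o′ ⊔ r′) where
  private
    module P = IndexedPreorder P
    module Q = IndexedPreorder Q
  field
    at      : {I : Set ℓ} → P.Pred I → Q.Pred I
    mono    : {I : Set ℓ} {φ ψ : P.Pred I} → φ P.≤ ψ → at φ Q.≤ at ψ
    natural : {I J : Set ℓ} (u : I → J) (φ : P.Pred J) → at (u P.^* φ) Q.≅ u Q.^* at φ

infix 4 _≃_

record _≃_ (P : IndexedPreorder ℓ o r) (Q : IndexedPreorder ℓ o′ r′)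
       : Set (lsuc ℓ ⊔ o ⊔ r ⊔ o′ ⊔ r′) where
  private
    module P = IndexedPreorder P
    module Q = IndexedPreorder Q
  field
    forth : PseudonaturalTransformation P Q
    back  : PseudonaturalTransformation Q P
  module F = PseudonaturalTransformation forth
  module G = PseudonaturalTransformation back
  field
    back∘forth : {I : Set ℓ} (φ : P.Pred I) → G.at (F.at φ) P.≅ φ
    forth∘back : {I : Set ℓ} (ψ : Q.Pred I) → F.at (G.at ψ) Q.≅ ψ

module _ (P : IndexedPreorder ℓ o r) where
  open IndexedPreorder P

  record HasFiniteMeets : Set (lsuc ℓ ⊔ o ⊔ r) where
    infixr 7 _∧_
    field
      ⊤       : {I : Set ℓ} → Pred I
      _∧_     : {I : Set ℓ} → Pred I → Pred I → Pred I
      maximum : {I : Set ℓ} → Maximum (_≤_ {I}) ⊤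
      infimum : {I : Set ℓ} → Infimum (_≤_ {I}) _∧_
      ^*-⊤    : {I J : Set ℓ} (u : I → J) → u ^* ⊤ ≅ ⊤
      ^*-∧    : {I J : Set ℓ} (u : I → J) (φ ψ : Pred J) → u ^* (φ ∧ ψ) ≅ (u ^* φ) ∧ (u ^* ψ)

  record HasImplication (meets : HasFiniteMeets) : Set (lsuc ℓ ⊔ o ⊔ r) where
    open HasFiniteMeets meets
    infixr 6 _⇨_
    field
      _⇨_         : {I : Set ℓ} → Pred I → Pred I → Pred I
      exponential : {I : Set ℓ} → Exponential (_≤_ {I}) _∧_ _⇨_
      ^*-⇨        : {I J : Set ℓ} (u : I → J) (φ ψ : Pred J) → u ^* (φ ⇨ ψ) ≅ (u ^* φ) ⇨ (u ^* ψ)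

  record HasUniversal : Set (lsuc ℓ ⊔ o ⊔ r) where
    field
      ∀[_]          : {I J : Set ℓ} → (I → J) → Pred I → Pred J
      ∀-adjoint     : {I J : Set ℓ} (u : I → J) (φ : Pred J) (ψ : Pred I) →
                      (u ^* φ ≤ ψ) ⇔ (φ ≤ ∀[ u ] ψ)
      beckChevalley : {X I J K : Set ℓ} {p : X → I} {q : X → J} {u : I → K} {v : J → K} →
                      IsPullback p q u v → (φ : Pred I) → v ^* ∀[ u ] φ ≅ ∀[ q ] (p ^* φ)

  record HasExistential : Set (lsuc ℓ ⊔ o ⊔ r) where
    field
      ∃[_]          : {I J : Set ℓ} → (I → J) → Pred I → Pred J
      ∃-adjoint     : {I J : Set ℓ} (u : I → J) (φ : Pred I) (ψ : Pred J) →
                      (∃[ u ] φ ≤ ψ) ⇔ (φ ≤ u ^* ψ)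
      beckChevalley : {X I J K : Set ℓ} {p : X → I} {q : X → J} {u : I → K} {v : J → K} →
                      IsPullback p q u v → (φ : Pred I) → v ^* ∃[ u ] φ ≅ ∃[ q ] (p ^* φ)

  IsGeneric : {C : Set ℓ} → Pred C → Set (lsuc ℓ ⊔ o ⊔ r)
  IsGeneric {C} ι = {B : Set ℓ} (φ : Pred B) → Σ[ f ∈ (B → C) ] (φ ≅ f ^* ι)

  IsDiscrete : {I : Set ℓ} → Pred I → Set (lsuc ℓ ⊔ o ⊔ r)
  IsDiscrete {I} δ =
    {J K : Set ℓ} (e : K → J) → StrictlySurjective _≡_ e → (f : K → I) (φ : Pred J) →
    e ^* φ ≤ f ^* δ → Σ[ g ∈ (J → I) ] (g ∘ e ≗ f)

-- Ord consists of preorders in the same universe as the base category.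

record Tripos (ℓ : Level) : Set (lsuc ℓ) where
  field
    indexedPreorder : IndexedPreorder ℓ ℓ ℓ
  open IndexedPreorder indexedPreorder public
  field
    finiteMeets : HasFiniteMeets indexedPreorder
    implication : HasImplication indexedPreorder finiteMeets
    universal   : HasUniversal indexedPreorder
    generic     : Σ[ C ∈ Set ℓ ] Σ[ ι ∈ Pred C ] IsGeneric indexedPreorder ι

-- Existential quantification in a tripos, by the second-order encoding
--   (∃ᵤ φ)(j)  =  ∀ c : C. (∀ i. u i = j → φ(i) ⇒ ι(c)) ⇒ ι(c).

module TriposExistential (𝒯 : Tripos ℓ) where
  open Tripos 𝒯
  open HasFiniteMeets finiteMeets
  open HasImplication implication
  open HasUniversal universal
  private
    C = proj₁ generic
    ι = proj₁ (proj₂ generic)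

    variable
      I J K X : Set ℓ

    _×C : (I → J) → I × C → J × C
    (u ×C) (i , c) = u i , c

    infixr 2 _⨾_
    _⨾_ : {φ ψ χ : Pred I} → φ ≤ ψ → ψ ≤ χ → φ ≤ χ
    _⨾_ = ≤-trans

    ∧₁ : {φ ψ : Pred I} → φ ∧ ψ ≤ φ
    ∧₁ = proj₁ (infimum _ _)

    ∧₂ : {φ ψ : Pred I} → φ ∧ ψ ≤ ψ
    ∧₂ = proj₁ (proj₂ (infimum _ _))

    ⟨_,_⟩ : {φ ψ χ : Pred I} → χ ≤ φ → χ ≤ ψ → χ ≤ φ ∧ ψ
    ⟨ a , b ⟩ = proj₂ (proj₂ (infimum _ _)) _ a b

    curry⇨ : {φ ψ χ : Pred I} → φ ∧ ψ ≤ χ → φ ≤ ψ ⇨ χ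
    curry⇨ = proj₁ (exponential _ _ _)

    uncurry⇨ : {φ ψ χ : Pred I} → φ ≤ ψ ⇨ χ → φ ∧ ψ ≤ χ
    uncurry⇨ = proj₂ (exponential _ _ _)

    ∀-intro : (u : I → J) {φ : Pred J} {ψ : Pred I} → u ^* φ ≤ ψ → φ ≤ ∀[ u ] ψ
    ∀-intro u = Equivalence.to (∀-adjoint u _ _)

    ∀-elim : (u : I → J) {φ : Pred J} {ψ : Pred I} → φ ≤ ∀[ u ] ψ → u ^* φ ≤ ψ
    ∀-elim u = Equivalence.from (∀-adjoint u _ _)

    square : {u : I → J} {v : J → K} {u′ : I → X} {v′ : X → K} (φ : Pred K) →
             v ∘ u ≗ v′ ∘ u′ → u ^* v ^* φ ≤ u′ ^* v′ ^* φ
    square {u = u} {v} {u′} {v′} φ eq =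
      proj₂ (^*-∘ u v φ) ⨾ proj₁ (^*-cong eq φ) ⨾ proj₁ (^*-∘ u′ v′ φ)

    transpose : {p : X → I} {q : X → J} {u : I → K} {v : J → K} →
                IsPullback p q u v → IsPullback q p v u
    transpose pb = record
      { commutes  = λ x → sym (commutes x)
      ; universal = λ f g eq →
          let h , a , b , uniq = IsPullback.universal pb g f (λ y → sym (eq y))
          in  h , b , a , λ h′ c d → uniq h′ d c }
      where open IsPullback pb

    graphPullback : (u : I → J) (f : J → C) →
      IsPullback (λ i → i , f (u i)) u (u ×C) (λ j → j , f j)
    graphPullback u f = record
      { commutes  = λ _ → refl
      ; universal = λ g h eq →
          (λ y → proj₁ (g y)) ,
          (λ y → cong₂ _,_ refl (trans (cong f (cong proj₁ (eq y))) (sym (cong proj₂ (eq y))))) ,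
          (λ y → cong proj₁ (eq y)) ,
          λ h′ a b y → cong proj₁ (a y) }

    productPullback : (u : I → J) →
      IsPullback (u ×C) proj₁ proj₁ u
    productPullback u = record
      { commutes  = λ _ → refl
      ; universal = λ g h eq →
          (λ y → h y , proj₂ (g y)) ,
          (λ y → cong₂ _,_ (sym (eq y)) refl) ,
          (λ _ → refl) ,
          λ h′ a b y → cong₂ _,_ (b y) (cong proj₂ (a y)) }

    matrix : Pred I → Pred (I × C)
    matrix φ = proj₁ ^* φ ⇨ proj₂ ^* ι

    premise : (u : I → J) → Pred I → Pred (J × C)
    premise u φ = ∀[ u ×C ] (matrix φ)

  ∃ᵀ : (I → J) → Pred I → Pred J
  ∃ᵀ u φ = ∀[ proj₁ ] (premise u φ ⇨ proj₂ ^* ι)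

  private
    unit : (u : I → J) (φ : Pred I) → φ ≤ u ^* ∃ᵀ u φ
    unit u φ =
      ∀-intro proj₁ (curry⇨ (⟨ ∧₂ ⨾ ∀-elim (u ×C) ≤-refl , ∧₁ ⟩ ⨾ uncurry⇨ ≤-refl
                      ⨾ proj₁ (^*-∘ (u ×C) proj₂ ι)) ⨾ proj₂ (^*-⇨ (u ×C) _ _))
      ⨾ proj₂ (beckChevalley (productPullback u) _)

    least : (u : I → J) (φ : Pred I) (χ : Pred J) → φ ≤ u ^* χ → ∃ᵀ u φ ≤ χ
    least {I = I} {J = J} u φ χ hyp =
      ⟨ toImp , true ⟩ ⨾ uncurry⇨ ≤-refl ⨾ proj₂ (^*-∘ γ proj₂ ι) ⨾ proj₂ χ≅
      where
      f = proj₁ (proj₂ (proj₂ generic) χ)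
      χ≅ = proj₂ (proj₂ (proj₂ generic) χ)
      γ : J → J × C
      γ j = j , f j
      γ′ : I → I × C
      γ′ i = i , f (u i)
      toImp : ∃ᵀ u φ ≤ γ ^* premise u φ ⇨ γ ^* proj₂ ^* ι
      toImp = proj₂ (^*-id _) ⨾ proj₁ (^*-∘ γ proj₁ _)
            ⨾ ^*-mono γ (∀-elim proj₁ ≤-refl) ⨾ proj₁ (^*-⇨ γ _ _)
      true : ∃ᵀ u φ ≤ γ ^* premise u φ
      true = ∀-intro u (curry⇨ (∧₂ ⨾ proj₂ (^*-∘ γ′ proj₁ φ) ⨾ proj₁ (^*-id φ) ⨾ hyp
                                ⨾ ^*-mono u (proj₁ χ≅) ⨾ square ι (λ _ → refl))
                        ⨾ proj₂ (^*-⇨ γ′ _ _))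
           ⨾ proj₂ (beckChevalley (graphPullback u f) _)

    adjoint : (u : I → J) (φ : Pred I) (ψ : Pred J) → (∃ᵀ u φ ≤ ψ) ⇔ (φ ≤ u ^* ψ)
    adjoint u φ ψ = mk⇔ (λ le → unit u φ ⨾ ^*-mono u le) (least u φ ψ)

  existential : HasExistential indexedPreorder
  existential = record
    { ∃[_]          = ∃ᵀ
    ; ∃-adjoint     = adjoint
    ; beckChevalley = λ {_} {_} {_} {_} {p} {q} {u} {v} pb φ →
        ∀-elim v (least u φ _ (∀-intro p (unit q (p ^* φ)) ⨾ proj₂ (beckChevalley (transpose pb) _))) ,
        least q _ _ (^*-mono p (unit u φ) ⨾ square _ (IsPullback.commutes pb))
    }

module _ (P : IndexedPreorder ℓ o r) (E : HasExistential P) where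
  open IndexedPreorder P
  open HasExistential E

  IsPrime : {I : Set ℓ} → Pred I → Set (lsuc ℓ ⊔ o ⊔ r)
  IsPrime {I} π =
    {J K : Set ℓ} (u : J → I) (v : K → J) (φ : Pred K) → u ^* π ≤ ∃[ v ] φ →
    Σ[ s ∈ (J → K) ] (v ∘ s ≗ id) × (u ^* π ≤ s ^* φ)

  HasEnoughPrimes : Set (lsuc ℓ ⊔ o ⊔ r)
  HasEnoughPrimes =
    {I : Set ℓ} (φ : Pred I) →
    Σ[ K ∈ Set ℓ ] Σ[ u ∈ (K → I) ] Σ[ π ∈ Pred K ] IsPrime π × (φ ≅ ∃[ u ] π)

  IsPrime-^* : {I J : Set ℓ} (w : J → I) {π : Pred I} → IsPrime π → IsPrime (w ^* π)
  IsPrime-^* w {π} prime u v φ le =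
    let s , section , le′ = prime (w ∘ u) v φ (≤-trans (proj₁ (^*-∘ u w π)) le)
    in  s , section , ≤-trans (proj₂ (^*-∘ u w π)) le′

  prim : IndexedPreorder ℓ (lsuc ℓ ⊔ o ⊔ r) r
  prim = record
    { Pred       = λ I → Σ (Pred I) IsPrime
    ; _≤_        = λ π ρ → proj₁ π ≤ proj₁ ρ
    ; isPreorder = record
        { isEquivalence = isEquivalence
        ; reflexive     = λ { refl → ≤-refl }
        ; trans         = ≤-trans }
    ; _^*_       = λ u π → u ^* proj₁ π , IsPrime-^* u (proj₂ π)
    ; ^*-mono    = λ u → ^*-mono u
    ; ^*-cong    = λ eq π → ^*-cong eq (proj₁ π)
    ; ^*-id      = λ π → ^*-id (proj₁ π)
    ; ^*-∘       = λ u v π → ^*-∘ u v (proj₁ π)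
    }

HasDiscreteGeneric : IndexedPreorder ℓ o r → Set (lsuc ℓ ⊔ o ⊔ r)
HasDiscreteGeneric {ℓ} P =
  Σ[ C ∈ Set ℓ ] Σ[ δ ∈ IndexedPreorder.Pred P C ] IsGeneric P δ × IsDiscrete P δ

-- Subsets as characteristic functions.  Under excluded middle these are all
-- the subsets, and the powerset stays in the universe of the set.

𝒫 : Set ℓ → Set ℓ
𝒫 A = A → Bool

infix 4 _∈_
_∈_ : {A : Set ℓ} → A → 𝒫 A → Set
a ∈ S = T (S a)

record RelativePCA (ℓ : Level) : Set (lsuc ℓ) where
  infixl 7 _·_ _⊙_
  field
    A    : Set ℓ
    _·_  : A → A → Maybe A
    A#   : 𝒫 A

  -- Application of partial terms: defined when both terms are and the
  -- application of their values is.  Kleene equality of partial terms is _≡_.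
  _⊙_ : Maybe A → Maybe A → Maybe A
  x ⊙ y = x >>= λ a → y >>= λ b → a · b

  field
    closed    : {a b c : A} → a ∈ A# → b ∈ A# → a · b ≡ just c → c ∈ A#
    k s       : A
    k∈        : k ∈ A#
    s∈        : s ∈ A#
    k-law     : ∀ a b → just k ⊙ just a ⊙ just b ≡ just a
    s-defined : ∀ a b → Σ[ c ∈ A ] (just s ⊙ just a ⊙ just b ≡ just c)
    s-law     : ∀ a b c → just s ⊙ just a ⊙ just b ⊙ just c ≡ (just a ⊙ just c) ⊙ (just b ⊙ just c)

module Realizability (𝒜 : RelativePCA ℓ) where
  open RelativePCA 𝒜

  _⊩_≤_ : {I : Set ℓ} → A → (φ ψ : I → 𝒫 A) → Set ℓ
  e ⊩ φ ≤ ψ = ∀ i a → a ∈ φ i → Σ[ b ∈ A ] (e · a ≡ just b) × (b ∈ ψ i)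

  _≤ᴿ_ : {I : Set ℓ} → Rel (I → 𝒫 A) ℓ
  φ ≤ᴿ ψ = Σ[ e ∈ A ] (e ∈ A#) × (e ⊩ φ ≤ ψ)

  private
    split : (x : Maybe A) {b c : A} → x ⊙ just b ≡ just c → Σ[ a ∈ A ] (x ≡ just a) × (a · b ≡ just c)
    split (just a) eq = a , refl , eq

    kₐ : ∀ a → Σ[ p ∈ A ] (k · a ≡ just p) × (∀ b → p · b ≡ just a)
    kₐ a with k · a | k-law a
    ... | just p  | law = p , refl , law
    ... | nothing | law with () ← law a

    sₐᵦ : ∀ a b → a ∈ A# → b ∈ A# →
          Σ[ t ∈ A ] (t ∈ A#) × (∀ c → t · c ≡ (just a ⊙ just c) ⊙ (just b ⊙ just c))
    sₐᵦ a b a∈ b∈ with s-defined a b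
    ... | t , eq with split (s · a) eq
    ...   | q , sa , qb =
      t , closed (closed s∈ a∈ sa) b∈ qb ,
      λ c → trans (cong (_⊙ just c) (sym eq)) (s-law a b c)

    identity : Σ[ i ∈ A ] (i ∈ A#) × (∀ a → i · a ≡ just a)
    identity with sₐᵦ k k k∈ k∈
    ... | i , i∈ , law = i , i∈ , λ a →
      let p , ka , pb = kₐ a
      in  trans (law a) (trans (cong (λ m → m ⊙ m) ka) (pb p))

    compose : ∀ e f → e ∈ A# → f ∈ A# →
              Σ[ g ∈ A ] (g ∈ A#) × (∀ {a b} → e · a ≡ just b → g · a ≡ f · b)
    compose e f e∈ f∈ with kₐ f
    ... | kf , kf≡ , kf-law with sₐᵦ kf e (closed k∈ f∈ kf≡) e∈
    ...   | g , g∈ , law = g , g∈ , λ {a} ea → trans (law a) (cong₂ _⊙_ (kf-law a) ea)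

    ≤ᴿ-refl : {I : Set ℓ} {φ : I → 𝒫 A} → φ ≤ᴿ φ
    ≤ᴿ-refl = let i , i∈ , law = identity in i , i∈ , λ _ a a∈ → a , law a , a∈

    ≤ᴿ-trans : {I : Set ℓ} {φ ψ χ : I → 𝒫 A} → φ ≤ᴿ ψ → ψ ≤ᴿ χ → φ ≤ᴿ χ
    ≤ᴿ-trans (e , e∈ , p) (f , f∈ , q) =
      let g , g∈ , law = compose e f e∈ f∈
      in  g , g∈ , λ i a a∈ →
            let b , ea , b∈ = p i a a∈
                c , fb , c∈ = q i b b∈
            in  c , trans (law ea) fb , c∈

    pointwise : {I : Set ℓ} {φ ψ : I → 𝒫 A} → (∀ i → φ i ≡ ψ i) → φ ≤ᴿ ψ
    pointwise eq =
      let i , i∈ , law = identity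
      in  i , i∈ , λ j a a∈ → a , law a , transport (eq j) a∈
      where
      transport : {S S′ : 𝒫 A} {a : A} → S ≡ S′ → a ∈ S → a ∈ S′
      transport refl a∈ = a∈

  realizabilityTripos : IndexedPreorder ℓ ℓ ℓ
  realizabilityTripos = record
    { Pred       = λ I → I → 𝒫 A
    ; _≤_        = _≤ᴿ_
    ; isPreorder = record
        { isEquivalence = isEquivalence
        ; reflexive     = λ { refl → ≤ᴿ-refl }
        ; trans         = ≤ᴿ-trans }
    ; _^*_       = λ u φ → φ ∘ u
    ; ^*-mono    = λ { u (e , e∈ , p) → e , e∈ , λ i → p (u i) }
    ; ^*-cong    = λ eq φ → pointwise (λ i → cong φ (eq i)) , pointwise (λ i → cong φ (sym (eq i)))
    ; ^*-id      = λ φ → ≤ᴿ-refl , ≤ᴿ-refl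
    ; ^*-∘       = λ u v φ → ≤ᴿ-refl , ≤ᴿ-refl
    }

open Realizability public using (realizabilityTripos)

IsRelativeRealizability : Tripos ℓ → Set (lsuc ℓ)
IsRelativeRealizability {ℓ} 𝒯 =
  Σ[ 𝒜 ∈ RelativePCA ℓ ] (Tripos.indexedPreorder 𝒯 ≃ realizabilityTripos 𝒜)

primᵀ : Tripos ℓ → IndexedPreorder ℓ (lsuc ℓ) ℓ
primᵀ 𝒯 = prim (Tripos.indexedPreorder 𝒯) (TriposExistential.existential 𝒯)

HasEnoughPrimesᵀ : Tripos ℓ → Set (lsuc ℓ)
HasEnoughPrimesᵀ 𝒯 = HasEnoughPrimes (Tripos.indexedPreorder 𝒯) (TriposExistential.existential 𝒯)

{-# OPTIONS --safe #-}
-- In a realizability tripos the ∃-primes are, up to isomorphism, the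
-- singleton-valued predicates {f(i)}; pairing makes them closed under finite
-- meets, and {id} on A is generic among them and discrete.
--
-- Conversely let δ on A be a discrete generic prime, and say that f tracks g
-- when f*δ ≤ g*δ; discreteness makes g a function of f.  Presenting the
-- predicate ∀ (a , b) ∈ h. δ(a) ⇒ δ(b) of a relation h ⊆ A × A as ∃ᵤ f*δ and
-- using primality, every partial function that is tracked uniformly in a
-- parameter is represented by a code f(k).  This gives a partial application
-- that satisfies the law of s only as an inequality.  It is repaired by letting
-- tagged pairs act as formal terms s·a·b, the new application being the least
-- fixed point; that application is again tracked, by a self-applied evaluator.
-- Enough primes then identify predicates on I with functions I → 𝒫 A.
module Submission where

open import Defs
open import Level using (Level; Lift; lift)
open import Axiom.ExcludedMiddle using (ExcludedMiddle)
open import Axiom.UniquenessOfIdentityProofs.WithK using (uip)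
open import Data.Bool.Base using (Bool; T; true; false; if_then_else_)
open import Data.Empty using (⊥-elim)
open import Data.Maybe.Base using (Maybe; just; nothing; _>>=_)
open import Data.Maybe.Properties using (just-injective)
open import Data.Product.Base using (Σ; Σ-syntax; _×_; _,_; proj₁; proj₂; uncurry)
open import Data.Sum.Base using (_⊎_; inj₁; inj₂)
open import Data.Unit.Polymorphic.Base using () renaming (⊤ to 𝟙; tt to ⋆)
open import Function.Base using (id; _∘_; const)
open import Function.Bundles using (_⇔_; mk⇔; Equivalence)
open import Relation.Binary.PropositionalEquality using (_≡_; refl; sym; trans; cong; cong₂; subst; subst₂; _≗_)
open import Relation.Nullary.Decidable using (yes; no; ⌊_⌋; toWitness; fromWitness)

private
  variable
    ℓ o r : Level

-- Propositions as Boolean truth values.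

module Decided (em : ExcludedMiddle ℓ) where

  ⌜_⌝ : Set ℓ → Bool
  ⌜ X ⌝ = ⌊ em {X} ⌋

  holds : {X : Set ℓ} → T ⌜ X ⌝ → X
  holds = toWitness {a? = em}

  decided : {X : Set ℓ} → X → T ⌜ X ⌝
  decided = fromWitness {a? = em}

-- Existential quantification and lifting properties of primes.

module Existential (P : IndexedPreorder ℓ o r) (E : HasExistential P) where
  open IndexedPreorder P
  open HasExistential E
  private
    variable
      I J K W : Set ℓ

  infixr 2 _⨾_
  _⨾_ : {φ ψ χ : Pred I} → φ ≤ ψ → ψ ≤ χ → φ ≤ χ
  _⨾_ = ≤-trans

  ∃-unit : (u : I → J) (φ : Pred I) → φ ≤ u ^* ∃[ u ] φ
  ∃-unit u φ = Equivalence.to (∃-adjoint u φ _) ≤-refl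

  ∃-least : (u : I → J) {φ : Pred I} {ψ : Pred J} → φ ≤ u ^* ψ → ∃[ u ] φ ≤ ψ
  ∃-least u = Equivalence.from (∃-adjoint u _ _)

  ∃-mono : (u : I → J) {φ ψ : Pred I} → φ ≤ ψ → ∃[ u ] φ ≤ ∃[ u ] ψ
  ∃-mono u le = ∃-least u (le ⨾ ∃-unit u _)

  IsPrime-≅ : {π ρ : Pred I} → π ≅ ρ → IsPrime P E π → IsPrime P E ρ
  IsPrime-≅ (π≤ρ , ρ≤π) prime u v φ le =
    let s , section , le′ = prime u v φ (^*-mono u π≤ρ ⨾ le)
    in  s , section , (^*-mono u ρ≤π ⨾ le′)

  canonicalPullback : (v : K → W) (h : J → W) →
    IsPullback {X = Σ[ j ∈ J ] Σ[ k ∈ K ] v k ≡ h j} (proj₁ ∘ proj₂) proj₁ v h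
  canonicalPullback v h = record
    { commutes  = proj₂ ∘ proj₂
    ; universal = λ f g eq →
        (λ y → g y , f y , eq y) , (λ _ → refl) , (λ _ → refl) ,
        λ h′ p≗ q≗ y → unique (h′ y) (q≗ y) (p≗ y) }
    where
    unique : ∀ x {j k} {eq : v k ≡ h j} → proj₁ x ≡ j → proj₁ (proj₂ x) ≡ k → x ≡ (j , k , eq)
    unique (j , k , eq) refl refl = cong (λ eq → j , k , eq) (uip eq _)

  -- Primality relative to an arbitrary base change: a section of the pullback
  -- of v along h is a lift of h along v.
  prime-lift : {π : Pred J} → IsPrime P E π → (h : J → W) (v : K → W) (φ : Pred K) →
               π ≤ h ^* ∃[ v ] φ → Σ[ t ∈ (J → K) ] (v ∘ t ≗ h) × (π ≤ t ^* φ)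
  prime-lift {π = π} prime h v φ le =
    let s , section , le′ = prime id proj₁ _ (proj₁ (^*-id π) ⨾ le ⨾ proj₁ (beckChevalley (canonicalPullback v h) φ))
    in  proj₁ ∘ proj₂ ∘ s ,
        (λ j → trans (proj₂ (proj₂ (s j))) (cong h (section j))) ,
        (proj₂ (^*-id π) ⨾ le′ ⨾ proj₂ (^*-∘ s (proj₁ ∘ proj₂) φ))

-- Combinatory completeness and pairing in a relative PCA.

module Combinators (𝒜 : RelativePCA ℓ) where
  open RelativePCA 𝒜

  constantly : ∀ a → Σ[ p ∈ A ] (k · a ≡ just p) × (∀ b → p · b ≡ just a)
  constantly a with k · a | k-law a
  ... | just p  | law = p , refl , law
  ... | nothing | law with () ← law a

  spread : ∀ a b → Σ[ t ∈ A ] (just s ⊙ just a ⊙ just b ≡ just t) ×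
           (∀ c → t · c ≡ (just a ⊙ just c) ⊙ (just b ⊙ just c))
  spread a b =
    let t , eq = s-defined a b
    in  t , eq , λ c → trans (cong (_⊙ just c) (sym eq)) (s-law a b c)

  -- Replaces bracket abstraction: a realizer of a term in one variable is assembled along the shape
  -- of the term.
  Computable : (A → Maybe A) → Set ℓ
  Computable m = Σ[ e ∈ A ] (e ∈ A#) × (∀ x → e · x ≡ m x)

  computable-const : ∀ {a} → a ∈ A# → Computable (λ _ → just a)
  computable-const {a} a∈ =
    let p , ka , law = constantly a in p , closed k∈ a∈ ka , law

  computable-⊙ : ∀ {m n} → Computable m → Computable n → Computable (λ x → m x ⊙ n x)
  computable-⊙ (a , a∈ , am) (b , b∈ , bn) with spread a b
  ... | t , eq , law with s · a in sa
  ...   | just q = t , closed (closed s∈ a∈ sa) b∈ eq , λ x → trans (law x) (cong₂ _⊙_ (am x) (bn x))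

  computable-· : ∀ {a} → a ∈ A# → Computable (a ·_)
  computable-· {a} a∈ = a , a∈ , λ _ → refl

  computable-id : Computable just
  computable-id =
    -- The combinator s k k.
    let i , i∈ , law = computable-⊙ (computable-· k∈) (computable-· k∈)
    in  i , i∈ , λ a →
          let p , ka , pb = constantly a
          in  trans (law a) (trans (cong (λ m → m ⊙ m) ka) (pb p))

  private
    i = proj₁ computable-id
    i∈ = proj₁ (proj₂ computable-id)
    i-law = proj₂ (proj₂ computable-id)

  -- The term s (s i (k m)) (k n), i.e. λz. z m n.
  pairTerm : Maybe A → Maybe A → Maybe A
  pairTerm m n = just s ⊙ (just s ⊙ just i ⊙ (just k ⊙ m)) ⊙ (just k ⊙ n)

  pairing : ∀ a b → Σ[ p ∈ A ] (pairTerm (just a) (just b) ≡ just p) ×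
            (∀ z → p · z ≡ just z ⊙ just a ⊙ just b)
  pairing a b =
    let ka , ka≡ , ka-law = constantly a
        kb , kb≡ , kb-law = constantly b
        t , t≡ , t-law = spread i ka
        p , p≡ , p-law = spread t kb
    in  p ,
        trans (cong₂ (λ m n → just s ⊙ m ⊙ n) (trans (cong (just s ⊙ just i ⊙_) ka≡) t≡) kb≡) p≡ ,
        λ z → trans (p-law z) (cong₂ _⊙_ (trans (t-law z) (cong₂ _⊙_ (i-law z) (ka-law z))) (kb-law z))

  pair : A → A → A
  pair a b = proj₁ (pairing a b)

  abstract
    computable-pair : ∀ {m n} → Computable m → Computable n → Computable (λ x → pairTerm (m x) (n x))
    computable-pair m n =
      computable-⊙ (computable-⊙ (computable-const s∈)
                     (computable-⊙ (computable-⊙ (computable-const s∈) (computable-const i∈))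
                       (computable-⊙ (computable-const k∈) m)))
                   (computable-⊙ (computable-const k∈) n)

  -- A pair is the function λz. z a b, so a selector is fed to it: `k` here, and k i for `snd`.
  fst : Computable (λ x → just x ⊙ just k)
  fst = computable-⊙ computable-id (computable-const k∈)

  fst-pair : ∀ a b → proj₁ fst · pair a b ≡ just a
  fst-pair a b = trans (proj₂ (proj₂ fst) _) (trans (proj₂ (proj₂ (pairing a b)) k) (k-law a b))

  private
    ki = constantly i

  snd : Computable (λ x → just x ⊙ just (proj₁ ki))
  snd = computable-⊙ computable-id (computable-const (closed k∈ i∈ (proj₁ (proj₂ ki))))

  snd-pair : ∀ a b → proj₁ snd · pair a b ≡ just b
  snd-pair a b =
    trans (proj₂ (proj₂ snd) _)
      (trans (proj₂ (proj₂ (pairing a b)) _)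
        (trans (cong (_⊙ just b) (proj₂ (proj₂ ki) a)) (i-law b)))

-- Primes of a realizability tripos.

module FromPCA (em : ExcludedMiddle ℓ) (P : IndexedPreorder ℓ o r) (finiteMeets : HasFiniteMeets P)
               (E : HasExistential P) (𝒜 : RelativePCA ℓ) (eqv : P ≃ realizabilityTripos 𝒜) where
  open Decided em
  open IndexedPreorder P
  open HasFiniteMeets finiteMeets
  open HasExistential E using (∃[_])
  open Existential P E
  open RelativePCA 𝒜
  open Combinators 𝒜
  open _≃_ eqv
  private
    module R = IndexedPreorder (realizabilityTripos 𝒜)
    Prime : {I : Set ℓ} → Pred I → Set _
    Prime = IsPrime P E
    variable
      I J K : Set ℓ

  infixr 2 _⨾ᴿ_
  _⨾ᴿ_ : {φ ψ χ : I → 𝒫 A} → φ R.≤ ψ → ψ R.≤ χ → φ R.≤ χ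
  _⨾ᴿ_ {φ = φ} {ψ} {χ} = R.≤-trans {φ = φ} {ψ} {χ}

  ⊆⇒≤ : {φ ψ : I → 𝒫 A} → (∀ i {a} → a ∈ φ i → a ∈ ψ i) → φ R.≤ ψ
  ⊆⇒≤ sub =
    let i , i∈ , law = computable-id
    in  i , i∈ , λ j a a∈ → a , law a , sub j a∈

  reflect : {φ ψ : Pred I} → F.at φ R.≤ F.at ψ → φ ≤ ψ
  reflect le = proj₂ (back∘forth _) ⨾ G.mono le ⨾ proj₁ (back∘forth _)

  transposeʳ : {φ : Pred I} {ψ : I → 𝒫 A} → F.at φ R.≤ ψ → φ ≤ G.at ψ
  transposeʳ le = proj₂ (back∘forth _) ⨾ G.mono le

  ∃ᴿ : (K → J) → (K → 𝒫 A) → J → 𝒫 A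
  ∃ᴿ {K = K} v φ j a = ⌜ Σ[ k ∈ K ] (v k ≡ j) × a ∈ φ k ⌝

  -- Each realizer over `k` lies in the union over the fibre of `v k`, so that union, carried back
  -- to `P`, is an upper bound, and `∃[ v ] φ` is the least one.
  forth-∃ : (v : K → J) (φ : Pred K) → F.at (∃[ v ] φ) R.≤ ∃ᴿ v (F.at φ)
  forth-∃ v φ = F.mono (∃-least v (transposeʳ le ⨾ proj₁ (G.natural v _))) ⨾ᴿ proj₁ (forth∘back _)
    where
    le : F.at φ R.≤ (∃ᴿ v (F.at φ) ∘ v)
    le = ⊆⇒≤ λ k a∈ → decided (k , refl , a∈)

  ｛_｝ : (I → A) → I → 𝒫 A
  ｛ f ｝ i a = ⌜ f i ≡ a ⌝

  ｛｝-≤ : {f : I → A} {ψ : I → 𝒫 A} → (∀ i → f i ∈ ψ i) → ｛ f ｝ R.≤ ψ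
  ｛｝-≤ {ψ = ψ} mem = ⊆⇒≤ λ i a∈ → subst (_∈ ψ i) (holds a∈) (mem i)

  Represents : (I → A) → Pred I → Set ℓ
  Represents f π = F.at π R.≅ ｛ f ｝

  represented-back : (f : I → A) → Represents f (G.at ｛ f ｝)
  represented-back f = forth∘back ｛ f ｝

  -- A singleton has one element, so over each `j` the realizer of the hypothesis has one output. A
  -- point of the fibre of `v` at which this output realizes `φ` is the value of the section.
  represented⇒prime : {f : I → A} {π : Pred I} → Represents f π → Prime π
  represented⇒prime {f = f} {π} (π≤f , f≤π) {K = K} u v φ le = t , section , reflect below
    where
    realized : ｛ f ∘ u ｝ R.≤ ∃ᴿ v (F.at φ)
    realized = R.^*-mono u {φ = ｛ f ｝} f≤π ⨾ᴿ proj₂ (F.natural u π) ⨾ᴿ F.mono le ⨾ᴿ forth-∃ v φ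
    e = proj₁ realized
    value : ∀ j → _
    value j = proj₂ (proj₂ realized) j (f (u j)) (decided refl)
    fibre : ∀ j → Σ[ k ∈ K ] (v k ≡ j) × proj₁ (value j) ∈ F.at φ k
    fibre j = holds (proj₂ (proj₂ (value j)))
    t = proj₁ ∘ fibre
    section : v ∘ t ≗ id
    section = proj₁ ∘ proj₂ ∘ fibre
    along : ｛ f ∘ u ｝ R.≤ (F.at φ ∘ t)
    along = e , proj₁ (proj₂ realized) , λ j a a∈ →
      proj₁ (value j) ,
      subst (λ a → e · a ≡ just (proj₁ (value j))) (holds a∈) (proj₁ (proj₂ (value j))) ,
      proj₂ (proj₂ (fibre j))
    below : F.at (u ^* π) R.≤ F.at (t ^* φ)
    below = proj₁ (F.natural u π) ⨾ᴿ R.^*-mono u {ψ = ｛ f ｝} π≤f ⨾ᴿ along ⨾ᴿ proj₂ (F.natural t φ)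

  -- A predicate is the union of its singletons, indexed by pairs of a point and a realizer there.
  enough : HasEnoughPrimes P E
  enough {I} φ = Elements , u , G.at ｛ f ｝ , represented⇒prime (represented-back f) , lower , upper
    where
    Elements = Σ[ i ∈ I ] Σ[ a ∈ A ] a ∈ F.at φ i
    u : Elements → I
    u = proj₁
    f : Elements → A
    f = proj₁ ∘ proj₂
    upper : ∃[ u ] (G.at ｛ f ｝) ≤ φ
    upper = ∃-least u (reflect (proj₁ (represented-back f)
      ⨾ᴿ ｛｝-≤ (proj₂ ∘ proj₂) ⨾ᴿ proj₂ (F.natural u φ)))
    lower : φ ≤ ∃[ u ] (G.at ｛ f ｝)
    lower with F.mono (∃-unit u (G.at ｛ f ｝))
    ... | unit = reflect (covered (proj₂ (represented-back f) ⨾ᴿ unit ⨾ᴿ proj₁ (F.natural u _)))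
      where
      -- The realizer is kept: having it work on every singleton over `Elements` is the same as
      -- having it work on `F.at φ`.
      covered : {ψ : I → 𝒫 A} → ｛ f ｝ R.≤ (ψ ∘ u) → F.at φ R.≤ ψ
      covered (e , e∈ , real) = e , e∈ , λ i a a∈ → real (i , a , a∈) a (decided refl)

  -- Primality gives a section of the cover of `π` by its elements. The section picks one realizer
  -- `f i` at each point, and the accompanying inequality bounds `π` by these singletons.
  prime⇒represented : {π : Pred I} → Prime π → Σ[ f ∈ (I → A) ] Represents f π
  prime⇒represented {I} {π} prime =
    let K , u , σ , _ , π≤ , _ = enough π
        s , section , le = prime id u σ (proj₁ (^*-id π) ⨾ π≤)
        f = proj₁ ∘ proj₂ ∘ s
        member : ∀ i → f i ∈ F.at π i
        member i = subst (λ j → f i ∈ F.at π j) (section i) (proj₂ (proj₂ (s i)))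
    in  f ,
        (F.mono (proj₂ (^*-id π) ⨾ le) ⨾ᴿ proj₁ (F.natural s σ)
          ⨾ᴿ R.^*-mono s {ψ = ｛ proj₁ ∘ proj₂ ｝} (proj₁ (represented-back _))) ,
        ｛｝-≤ member

  ⊤-prime : Prime (⊤ {I})
  -- Any element of `A#` would serve in place of `k`.
  ⊤-prime {I} = represented⇒prime {f = const k}
    ( (let e , e∈ , law = computable-const k∈ in e , e∈ , λ _ a _ → k , law a , decided refl)
    , (proj₂ (represented-back _) ⨾ᴿ F.mono (maximum _)) )

  -- The singletons of pairs form a meet of the singletons of the components, by `paired` and the
  -- two projections.
  ∧-prime : {π ρ : Pred I} → Prime π → Prime ρ → Prime (π ∧ ρ)
  ∧-prime {I} {π} {ρ} π-prime ρ-prime = represented⇒prime {f = h} (lower , upper)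
    where
    f,≅ = prime⇒represented π-prime
    g,≅ = prime⇒represented ρ-prime
    f = proj₁ f,≅
    g = proj₁ g,≅
    h : I → A
    h i = pair (f i) (g i)
    glb = infimum π ρ
    paired : {χ : I → 𝒫 A} → χ R.≤ ｛ f ｝ → χ R.≤ ｛ g ｝ → χ R.≤ ｛ h ｝
    paired (d , d∈ , dreal) (e , e∈ , ereal) =
      let q , q∈ , law = computable-pair (computable-· d∈) (computable-· e∈)
      in  q , q∈ , λ i a a∈ →
            let b , da , b∈ = dreal i a a∈
                c , ea , c∈ = ereal i a a∈
            in  pair (f i) (g i) ,
                trans (law a) (trans (cong₂ pairTerm (trans da (cong just (sym (holds b∈))))
                                                     (trans ea (cong just (sym (holds c∈)))))
                                     (proj₁ (proj₂ (pairing (f i) (g i))))) ,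
                decided refl
    lower : F.at (π ∧ ρ) R.≤ ｛ h ｝
    lower = paired (F.mono (proj₁ glb) ⨾ᴿ proj₁ (proj₂ f,≅)) (F.mono (proj₁ (proj₂ glb)) ⨾ᴿ proj₁ (proj₂ g,≅))
    projected : {l : I → A} (c : Σ[ e ∈ A ] e ∈ A#) → (∀ i → proj₁ c · h i ≡ just (l i)) → ｛ h ｝ R.≤ ｛ l ｝
    projected {l} (e , e∈) law = e , e∈ , λ i a a∈ →
      l i , subst (λ a → e · a ≡ just (l i)) (holds a∈) (law i) , decided refl
    upper : ｛ h ｝ R.≤ F.at (π ∧ ρ)
    upper = proj₂ (represented-back h) ⨾ᴿ F.mono (proj₂ (proj₂ glb) _
      (reflect (proj₁ (represented-back h) ⨾ᴿ projected (proj₁ fst , proj₁ (proj₂ fst)) (λ i → fst-pair _ _) ⨾ᴿ proj₂ (proj₂ f,≅)))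
      (reflect (proj₁ (represented-back h) ⨾ᴿ projected (proj₁ snd , proj₁ (proj₂ snd)) (λ i → snd-pair _ _) ⨾ᴿ proj₂ (proj₂ g,≅))))

  primeMeets : HasFiniteMeets (prim P E)
  primeMeets = record
    { ⊤       = ⊤ , ⊤-prime
    ; _∧_     = λ (π , π-prime) (ρ , ρ-prime) → π ∧ ρ , ∧-prime π-prime ρ-prime
    ; maximum = λ π → maximum (proj₁ π)
    ; infimum = λ π ρ →
        let l , r , g = infimum (proj₁ π) (proj₁ ρ) in l , r , λ χ → g (proj₁ χ)
    ; ^*-⊤    = ^*-⊤
    ; ^*-∧    = λ u π ρ → ^*-∧ u (proj₁ π) (proj₁ ρ)
    }

  discreteGeneric : HasDiscreteGeneric (prim P E)
  discreteGeneric = A , (δ , represented⇒prime (represented-back id)) , generic-δ , discrete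
    where
    δ = G.at ｛ id ｝
    generic-δ : IsGeneric (prim P E) (δ , represented⇒prime (represented-back id))
    generic-δ (π , prime) =
      let f , π≤f , f≤π = prime⇒represented prime
      in  f ,
          reflect (π≤f ⨾ᴿ R.^*-mono f {φ = ｛ id ｝} (proj₂ (represented-back id)) ⨾ᴿ proj₂ (F.natural f δ)) ,
          reflect (proj₁ (F.natural f δ) ⨾ᴿ R.^*-mono f {ψ = ｛ id ｝} (proj₁ (represented-back id)) ⨾ᴿ f≤π)
    discrete : IsDiscrete (prim P E) (δ , represented⇒prime (represented-back id))
    discrete {J} {K} e surjective f (φ , prime) le =
      -- The function sought applies `f` to some preimage under `e`. By `track`, `f k` is the result
      -- of one realizer at `w (e k)`, so the choice of preimage does not matter.
      f ∘ proj₁ ∘ surjective , λ k → just-injective (trans (sym (track (proj₁ (surjective (e k)))))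
        (trans (cong (λ j → proj₁ realized · w j) (proj₂ (surjective (e k)))) (track k)))
      where
      represented = prime⇒represented prime
      w = proj₁ represented
      realized : (｛ w ∘ e ｝) R.≤ ｛ f ｝
      realized = R.^*-mono e {φ = ｛ w ｝} (proj₂ (proj₂ represented)) ⨾ᴿ proj₂ (F.natural e φ)
        ⨾ᴿ F.mono le ⨾ᴿ proj₁ (F.natural f δ) ⨾ᴿ R.^*-mono f {ψ = ｛ id ｝} (proj₁ (represented-back id))
      track : ∀ k → proj₁ realized · w (e k) ≡ just (f k)
      track k =
        let b , eq , b∈ = proj₂ (proj₂ realized) k (w (e k)) (decided refl)
        in  trans eq (cong just (sym (holds b∈)))

-- Primes with a discrete generic predicate.

module FromPrimes (em : ExcludedMiddle ℓ) (P : IndexedPreorder ℓ o ℓ) (finiteMeets : HasFiniteMeets P)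
                  (implication : HasImplication P finiteMeets) (universal : HasUniversal P)
                  (E : HasExistential P) (enough : HasEnoughPrimes P E)
                  (primeMeets : HasFiniteMeets (prim P E))
                  (discreteGeneric : HasDiscreteGeneric (prim P E)) where
  open Decided em
  open IndexedPreorder P
  open HasFiniteMeets finiteMeets
  open HasImplication implication
  open HasUniversal universal using (∀[_]; ∀-adjoint; beckChevalley)
  open HasExistential E using (∃[_]) renaming (beckChevalley to ∃-beckChevalley)
  open Existential P E
  private
    module M = HasFiniteMeets primeMeets
    variable
      I J : Set ℓ

  A : Set ℓ
  A = proj₁ discreteGeneric

  δ : Pred A
  δ = proj₁ (proj₁ (proj₂ discreteGeneric))

  δ-prime : IsPrime P E δ
  δ-prime = proj₂ (proj₁ (proj₂ discreteGeneric))

  ^*δ-prime : (f : I → A) → IsPrime P E (f ^* δ)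
  ^*δ-prime f = IsPrime-^* P E f δ-prime

  -- Tracking, pairing and designated elements.

  infix 4 _⊢_
  _⊢_ : (I → A) → (I → A) → Set ℓ
  f ⊢ g = f ^* δ ≤ g ^* δ

  ⊢-reindex : (t : J → I) {f g : I → A} → f ⊢ g → f ∘ t ⊢ g ∘ t
  ⊢-reindex t le = proj₁ (^*-∘ t _ δ) ⨾ ^*-mono t le ⨾ proj₂ (^*-∘ t _ δ)

  abstract
    presentation : (φ : Pred I) →
      Σ[ K ∈ Set ℓ ] Σ[ u ∈ (K → I) ] Σ[ f ∈ (K → A) ] (φ ≅ ∃[ u ] (f ^* δ))
    presentation φ =
      let K , u , π , prime , φ≤ , ≤φ = enough φ
          f , π≤ , ≤π = proj₁ (proj₂ (proj₂ discreteGeneric)) (π , prime)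
      in  K , u , f , (φ≤ ⨾ ∃-mono u π≤) , (∃-mono u ≤π ⨾ ≤φ)

  private
    discrete : IsDiscrete (prim P E) (proj₁ (proj₂ discreteGeneric))
    discrete = proj₂ (proj₂ (proj₂ discreteGeneric))

  -- Discreteness for the surjection from two points onto one.
  ⊢-functional : {f g : I → A} → f ⊢ g → ∀ {i j} → f i ≡ f j → g i ≡ g j
  ⊢-functional {I} {f} {g} le {i} {j} eq =
    let h , h≗ = discrete {J = 𝟙} {K = Lift ℓ Bool} (const ⋆) (λ _ → lift true , refl) (g ∘ point)
                   (const (f i) ^* δ , ^*δ-prime _)
                   (proj₂ (^*-∘ _ _ δ) ⨾ proj₁ (^*-cong agree δ) ⨾ ⊢-reindex point le)
    in  trans (sym (h≗ (lift true))) (h≗ (lift false))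
    where
    point : Lift ℓ Bool → I
    point (lift b) = if b then i else j
    agree : ∀ b → f i ≡ f (point b)
    agree (lift true)  = refl
    agree (lift false) = eq

  -- A finite meet of primes taken among the primes is a meet among all
  -- predicates, since a predicate is a union of primes.
  abstract
    pairing : Σ[ p ∈ (A × A → A) ] ((p ^* δ) ≅ (proj₁ ^* δ) ∧ (proj₂ ^* δ))
    pairing =
      let p , ≤p , p≤ = proj₁ (proj₂ (proj₂ discreteGeneric)) (left M.∧ right)
          l , r , _ = M.infimum left right
      in  p , proj₂ (proj₂ (infimum _ _)) _ (p≤ ⨾ l) (p≤ ⨾ r) , (below ⨾ ≤p)
      where
      left right : IndexedPreorder.Pred (prim P E) (A × A)
      left  = proj₁ ^* δ , ^*δ-prime proj₁
      right = proj₂ ^* δ , ^*δ-prime proj₂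
      below : proj₁ left ∧ proj₁ right ≤ proj₁ (left M.∧ right)
      below =
        let K , u , σ , prime , ≤σ , σ≤ = enough (proj₁ left ∧ proj₁ right)
            l , r , _ = infimum (proj₁ left) (proj₁ right)
            σ≤u = ∃-unit u σ ⨾ ^*-mono u σ≤
        in  ≤σ ⨾ ∃-least u (proj₂ (proj₂ (M.infimum _ _)) (σ , prime) (σ≤u ⨾ ^*-mono u l) (σ≤u ⨾ ^*-mono u r)
                             ⨾ proj₂ (M.^*-∧ u left right))

  p : A → A → A
  p a b = proj₁ pairing (a , b)

  ⊢-pair : {f g h : I → A} → f ⊢ g → f ⊢ h → f ⊢ (λ i → p (g i) (h i))
  ⊢-pair {g = g} {h} fg fh =
    proj₂ (proj₂ (infimum _ _)) _ (fg ⨾ proj₁ (^*-∘ g,h proj₁ δ)) (fh ⨾ proj₁ (^*-∘ g,h proj₂ δ))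
    ⨾ proj₂ (^*-∧ g,h _ _) ⨾ ^*-mono g,h (proj₂ (proj₂ pairing)) ⨾ proj₂ (^*-∘ g,h (proj₁ pairing) δ)
    where
    g,h : _ → A × A
    g,h i = g i , h i

  ⊢-proj₁ : {g h : I → A} → (λ i → p (g i) (h i)) ⊢ g
  ⊢-proj₁ {g = g} {h} = ⊢-reindex (λ i → g i , h i) (proj₁ (proj₂ pairing) ⨾ proj₁ (infimum _ _))

  ⊢-proj₂ : {g h : I → A} → (λ i → p (g i) (h i)) ⊢ h
  ⊢-proj₂ {g = g} {h} = ⊢-reindex (λ i → g i , h i) (proj₁ (proj₂ pairing) ⨾ proj₁ (proj₂ (infimum _ _)))

  -- A pair tracks both of its components, so discreteness makes them functions of it.
  p-injective : ∀ {a b a′ b′} → p a b ≡ p a′ b′ → (a ≡ a′) × (b ≡ b′)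
  p-injective eq =
    ⊢-functional (⊢-proj₁ {g = proj₁} {h = proj₂}) {_ , _} {_ , _} eq ,
    ⊢-functional (⊢-proj₂ {g = proj₁} {h = proj₂}) {_ , _} {_ , _} eq

  -- When `δ` consists of the singletons of a relative PCA, this recovers its designated subset: the
  -- constant function with value `a` is realized exactly if `a` is designated.
  Global : A → Set ℓ
  Global a = ⊤ {𝟙} ≤ const a ^* δ

  A# : 𝒫 A
  A# a = ⌜ Global a ⌝

  ≤-global : {a : A} {φ : Pred I} → Global a → φ ≤ const a ^* δ
  ≤-global global = maximum _ ⨾ proj₂ (^*-⊤ (const ⋆)) ⨾ ^*-mono (const ⋆) global ⨾ proj₂ (^*-∘ (const ⋆) _ δ)

  abstract
    -- The top prime is top among all predicates, since `⊤` is a union of primes. The resulting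
    -- element later serves as a dummy parameter.
    global-point : Σ[ c ∈ A ] Global c
    global-point =
      let c , ≤c , _ = proj₁ (proj₂ (proj₂ discreteGeneric)) (M.⊤ {𝟙})
          K , u , σ , prime , ≤σ , _ = enough (⊤ {𝟙})
      in  c ⋆ , (≤σ ⨾ ∃-least u (M.maximum (σ , prime) ⨾ proj₂ (M.^*-⊤ u)) ⨾ ≤c)

  -- Codes for uniformly tracked partial functions.

  Rel𝔹 : Set ℓ
  Rel𝔹 = A → A → Bool

  Graph : Set ℓ
  Graph = Σ[ h ∈ Rel𝔹 ] Σ[ a ∈ A ] Σ[ b ∈ A ] T (h a b)

  source target : Graph → A
  source (_ , a , _) = a
  target (_ , _ , b , _) = b

  -- Boolean-valued relations form a type in `Set ℓ`, so there is a predicate on all of them at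
  -- once.
  Tracked : Pred Rel𝔹
  Tracked = ∀[ proj₁ ] (source ^* δ ⇨ target ^* δ)

  private
    Code = proj₁ (presentation Tracked)
    relation = proj₁ (proj₂ (presentation Tracked))
    value = proj₁ (proj₂ (proj₂ (presentation Tracked)))
    Tracked≅ = proj₂ (proj₂ (proj₂ (presentation Tracked)))

  -- Several codes may share the value `e`. The union of their relations is taken, and it is
  -- single-valued by `App-functional`.
  App : A → A → A → Set ℓ
  App e a b = Σ[ k ∈ Code ] (value k ≡ e) × T (relation k a b)

  -- Modus ponens: a code entails `Tracked` of its relation, which is instantiated at the pair of
  -- argument and result and then applied to the argument.
  ⊢-App : {f g h i : I → A} → (∀ x → App (g x) (h x) (i x)) → f ⊢ g → f ⊢ h → f ⊢ i
  ⊢-App {I = I} {g = g} {h} {i} app fg fh =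
    proj₂ (proj₂ (infimum _ _)) _ (fg ⨾ code) (fh ⨾ proj₁ (^*-∘ t source δ))
    ⨾ proj₂ (exponential _ _ _) ≤-refl ⨾ proj₂ (^*-∘ t target δ)
    where
    k : I → Code
    k = proj₁ ∘ app
    t : I → Graph
    t x = relation (k x) , h x , i x , proj₂ (proj₂ (app x))
    code : g ^* δ ≤ t ^* source ^* δ ⇨ t ^* target ^* δ
    code = proj₁ (^*-cong (λ x → sym (proj₁ (proj₂ (app x)))) δ) ⨾ proj₁ (^*-∘ k value δ)
         ⨾ ^*-mono k (∃-unit relation _ ⨾ ^*-mono relation (proj₂ Tracked≅))
         ⨾ proj₂ (^*-∘ k relation _) ⨾ proj₁ (^*-∘ t proj₁ _)
         ⨾ ^*-mono t (Equivalence.from (∀-adjoint proj₁ _ _) ≤-refl) ⨾ proj₁ (^*-⇨ t _ _)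

  -- Over the set of all derivations, the pair of code and argument tracks the result, so the result
  -- is a function of that pair.
  App-functional : ∀ {e a b b′} → App e a b → App e a b′ → b ≡ b′
  App-functional {e} {a} d d′ =
    ⊢-functional {I = Σ[ e ∈ A ] Σ[ a ∈ A ] Σ[ b ∈ A ] App e a b} {f = λ (e , a , _) → p e a} {g = λ (_ , _ , b , _) → b}
      (⊢-App (λ (_ , _ , _ , d) → d) ⊢-proj₁ ⊢-proj₂) {e , a , _ , d} {e , a , _ , d′} refl

  private
    -- With Beck-Chevalley, this turns `h ^* Tracked` into a quantification over the pairs in each
    -- relation `h j`.
    graphPullback : (h : J → Rel𝔹) →
      IsPullback {X = Σ[ j ∈ J ] Σ[ a ∈ A ] Σ[ b ∈ A ] T (h j a b)} {I = Graph}
        (λ (j , a,b) → h j , a,b) proj₁ proj₁ h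
    graphPullback {J} h = record
      { commutes  = λ _ → refl
      ; universal = λ f g eq →
          (λ y → g y , fibre (f y) (eq y)) ,
          (λ y → fibre-≡ (f y) (eq y)) , (λ _ → refl) ,
          λ h′ a b y → unique (h′ y) (f y) (eq y) (a y) (b y) }
      where
      fibre : {j : J} (x : Graph) → proj₁ x ≡ h j → Σ[ a ∈ A ] Σ[ b ∈ A ] T (h j a b)
      fibre (_ , a,b) refl = a,b
      fibre-≡ : {j : J} (x : Graph) (eq : proj₁ x ≡ h j) → (h j , fibre x eq) ≡ x
      fibre-≡ (_ , _) refl = refl
      unique : (z : Σ[ j ∈ J ] Σ[ a ∈ A ] Σ[ b ∈ A ] T (h j a b)) {j : J} (x : Graph) (eq : proj₁ x ≡ h j) →
               (h (proj₁ z) , proj₂ z) ≡ x → proj₁ z ≡ j → z ≡ (j , fibre x eq)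
      unique (_ , _) _ refl refl refl = refl

  private
    module Representation (z : J → A) (q : I → J) (x y : I → A) (le : (λ i → p (z (q i)) (x i)) ⊢ y) where
      h : J → Rel𝔹
      h j a b = ⌜ Σ[ i ∈ I ] (q i ≡ j) × (x i ≡ a) × (y i ≡ b) ⌝
      Y : Set ℓ
      Y = Σ[ j ∈ J ] Σ[ a ∈ A ] Σ[ b ∈ A ] T (h j a b)
      into : Y → Graph
      into (j , a,b) = h j , a,b
      origin : (w : Y) → Σ[ i ∈ I ] (q i ≡ proj₁ w) × (x i ≡ source (into w)) × (y i ≡ target (into w))
      origin (j , a , b , w) = holds w
      z,source : Y → A × A
      z,source w = z (proj₁ w) , source (into w)
      tracked-on-Y : uncurry p ∘ z,source ⊢ target ∘ into
      tracked-on-Y =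
        proj₁ (^*-cong (λ w → let _ , q≡ , x≡ , _ = origin w in sym (cong₂ p (cong z q≡) x≡)) δ)
        ⨾ ⊢-reindex (proj₁ ∘ origin) le
        ⨾ proj₁ (^*-cong (λ w → proj₂ (proj₂ (proj₂ (origin w)))) δ)
      meet≤ : (proj₁ ^* z ^* δ) ∧ (into ^* source ^* δ) ≤ into ^* target ^* δ
      meet≤ =
        let l , r , _ = infimum (proj₁ ^* z ^* δ) (into ^* source ^* δ)
        in  proj₂ (proj₂ (infimum _ _)) _ (l ⨾ proj₂ (^*-∘ proj₁ z δ) ⨾ proj₁ (^*-∘ z,source proj₁ δ))
                                          (r ⨾ proj₂ (^*-∘ into source δ) ⨾ proj₁ (^*-∘ z,source proj₂ δ))
            ⨾ proj₂ (^*-∧ z,source _ _) ⨾ ^*-mono z,source (proj₂ (proj₂ pairing)) ⨾ proj₂ (^*-∘ z,source _ δ)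
            ⨾ tracked-on-Y ⨾ proj₁ (^*-∘ into target δ)
      tracked : z ^* δ ≤ h ^* Tracked
      tracked = Equivalence.to (∀-adjoint proj₁ _ _) (proj₁ (exponential _ _ _) meet≤ ⨾ proj₂ (^*-⇨ into _ _))
              ⨾ proj₂ (beckChevalley (graphPullback h) _)

  abstract
    -- Let `h j` relate `x i` to `y i` for all `i` over `j`. The hypothesis says that `z` entails
    -- `Tracked` of `h`; as `z ^* δ` is prime, `h` lifts along `relation` to a family of codes whose
    -- values `z` tracks.
    represent : (z : J → A) (q : I → J) (x y : I → A) → (λ i → p (z (q i)) (x i)) ⊢ y →
                Σ[ e ∈ (J → A) ] (z ⊢ e) × (∀ i → App (e (q i)) (x i) (y i))
    represent z q x y le =
      let open Representation z q x y le
          t , rel≗ , z⊢ = prime-lift (^*δ-prime z) h relation (value ^* δ) (tracked ⨾ ^*-mono h (proj₁ Tracked≅))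
      in  value ∘ t , (z⊢ ⨾ proj₂ (^*-∘ t value δ)) ,
          λ i → t (q i) , refl , subst (λ R → T (R (x i) (y i))) (sym (rel≗ (q i))) (decided (i , refl , refl , refl))

  represent-global : (x y : I → A) → x ⊢ y → Σ[ e ∈ A ] Global e × (∀ i → App e (x i) (y i))
  represent-global x y le =
    let c , global = global-point
        e , c⊢e , app = represent {J = 𝟙} (const c) (const ⋆) x y (⊢-proj₂ ⨾ le)
    in  e ⋆ , (global ⨾ c⊢e) , app

  -- Formal terms and their evaluation.

  private abstract
    T-rep : Σ[ e ∈ A ] Global e × (∀ ab → App e (uncurry p ab) (proj₁ ab))
    T-rep = represent-global {I = A × A} (uncurry p) proj₁ ⊢-proj₁

    F-rep : Σ[ e ∈ A ] Global e × (∀ ab → App e (uncurry p ab) (proj₂ ab))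
    F-rep = represent-global {I = A × A} (uncurry p) proj₂ ⊢-proj₂

  -- The codes of the projections double as tags: applied to a pair of alternatives, a tag selects
  -- one of them.
  tt ff : A
  tt = proj₁ T-rep
  ff = proj₁ F-rep

  App-tt : ∀ a b → App tt (p a b) a
  App-tt a b = proj₂ (proj₂ T-rep) (a , b)

  App-ff : ∀ a b → App ff (p a b) b
  App-ff a b = proj₂ (proj₂ F-rep) (a , b)

  -- App satisfies the law of s only up to definedness.  In the following
  -- application the elements p ff (p a b) stand for formal terms s·a·b, whose
  -- domain is thus the prescribed one, and p tt e acts as e does under App.
  data Eval (c x v : A) : Set ℓ where
    base : ∀ {e} → c ≡ p tt e → App e x v → Eval c x v
    fork : ∀ {a b u w} → c ≡ p ff (p a b) → Eval a x u → Eval b x w → Eval u w v → Eval c x v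

  -- An element r evaluates the subterms of a term by applying itself to (r , term).
  private
    Base = Σ[ r ∈ A ] Σ[ e ∈ A ] Σ[ x ∈ A ] Σ[ v ∈ A ] App e x v
    Fork = Σ[ r ∈ A ] Σ[ a ∈ A ] Σ[ b ∈ A ] Σ[ x ∈ A ] Σ[ u ∈ A ] Σ[ w ∈ A ] Σ[ v ∈ A ]
             App r (p r (p a x)) u × App r (p r (p b x)) w × App r (p r (p u w)) v

    tag recursor body argument result : Base ⊎ Fork → A
    tag (inj₁ _) = tt
    tag (inj₂ _) = ff
    recursor (inj₁ (r , _)) = r
    recursor (inj₂ (r , _)) = r
    body (inj₁ (r , e , _)) = e
    body (inj₂ (r , a , b , _)) = p a b
    argument (inj₁ (r , e , x , _)) = x
    argument (inj₂ (r , a , b , x , _)) = x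
    result (inj₁ (r , e , x , v , _)) = v
    result (inj₂ (r , a , b , x , u , w , v , _)) = v

    -- This has the form `p r (p c x)` with `c` a tagged term, matching the recursive calls recorded
    -- in `Fork`.
    input : Base ⊎ Fork → A
    input y = p (recursor y) (p (p (tag y) (body y)) (argument y))

    input⊢recursor : input ⊢ recursor
    input⊢recursor = ⊢-proj₁
    input⊢argument : input ⊢ argument
    input⊢argument = ⊢-proj₂ ⨾ ⊢-proj₂
    input⊢tag : input ⊢ tag
    input⊢tag = ⊢-proj₂ ⨾ ⊢-proj₁ ⨾ ⊢-proj₁
    input⊢body : input ⊢ body
    input⊢body = ⊢-proj₂ ⨾ ⊢-proj₁ ⨾ ⊢-proj₂

    base⊢ : input ∘ inj₁ ⊢ result ∘ inj₁
    base⊢ = ⊢-App (λ (_ , _ , _ , _ , d) → d) (⊢-reindex inj₁ input⊢body) (⊢-reindex inj₁ input⊢argument)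

    fork⊢ : input ∘ inj₂ ⊢ result ∘ inj₂
    fork⊢ = step (λ (_ , _ , _ , _ , _ , _ , _ , _ , _ , d) → d)
              (step (λ (_ , _ , _ , _ , _ , _ , _ , d , _) → d) (⊢-reindex inj₂ input⊢body ⨾ ⊢-proj₁) (⊢-reindex inj₂ input⊢argument))
              (step (λ (_ , _ , _ , _ , _ , _ , _ , _ , d , _) → d) (⊢-reindex inj₂ input⊢body ⨾ ⊢-proj₂) (⊢-reindex inj₂ input⊢argument))
      where
      step : {f g h : Fork → A} → (∀ y → App (proj₁ y) (p (proj₁ y) (p (f y) (g y))) (h y)) →
             input ∘ inj₂ ⊢ f → input ∘ inj₂ ⊢ g → input ∘ inj₂ ⊢ h
      step app f g = ⊢-App app (⊢-reindex inj₂ input⊢recursor) (⊢-pair (⊢-reindex inj₂ input⊢recursor) (⊢-pair f g))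

    -- The tag selects which of the two realizers is applied.
    input⊢result : input ⊢ result
    input⊢result =
      let d , d-global , d-app = represent-global _ _ base⊢
          e , e-global , e-app = represent-global _ _ fork⊢
          selected : Base ⊎ Fork → A
          selected = λ { (inj₁ _) → d ; (inj₂ _) → e }
      in  ⊢-App {g = selected} (λ { (inj₁ y) → d-app y ; (inj₂ y) → e-app y })
            (⊢-App {g = tag} {h = const (p d e)} (λ { (inj₁ _) → App-tt d e ; (inj₂ _) → App-ff d e })
              input⊢tag (⊢-pair (≤-global d-global) (≤-global e-global)))
            ≤-refl

  private abstract
    evaluator : Σ[ e ∈ A ] Global e × (∀ y → App e (input y) (result y))
    evaluator = represent-global input result input⊢result

    -- The realizer of `result` works for every `r`, so `r` may be the realizer itself. By induction
    -- on the derivation, the recursive calls that `Fork` demands are then available.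
    evaluate : ∀ {c x v} → Eval c x v → App (proj₁ evaluator) (p (proj₁ evaluator) (p c x)) v
    evaluate (base refl d) = proj₂ (proj₂ evaluator) (inj₁ (_ , _ , _ , _ , d))
    evaluate (fork refl d d′ d″) =
      proj₂ (proj₂ evaluator) (inj₂ (_ , _ , _ , _ , _ , _ , _ , evaluate d , evaluate d′ , evaluate d″))

  ⊢-Eval : {f g h i : I → A} → (∀ x → Eval (g x) (h x) (i x)) → f ⊢ g → f ⊢ h → f ⊢ i
  ⊢-Eval eval fg fh =
    ⊢-App (evaluate ∘ eval) (≤-global (proj₁ (proj₂ evaluator)))
      (⊢-pair (≤-global (proj₁ (proj₂ evaluator))) (⊢-pair fg fh))

  Eval-functional : ∀ {c x v v′} → Eval c x v → Eval c x v′ → v ≡ v′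
  Eval-functional d d′ = App-functional (evaluate d) (evaluate d′)

  represent-Eval : (z : J → A) (q : I → J) (x y : I → A) → (λ i → p (z (q i)) (x i)) ⊢ y →
                   Σ[ e ∈ (J → A) ] (z ⊢ e) × (∀ i → Eval (e (q i)) (x i) (y i))
  represent-Eval z q x y le =
    let e , z⊢e , app = represent z q x y le
    in  (λ j → p tt (e j)) , ⊢-pair (≤-global (proj₁ (proj₂ T-rep))) z⊢e , λ i → base refl (app i)

  represent-Eval-global : (x y : I → A) → x ⊢ y → Σ[ e ∈ A ] Global e × (∀ i → Eval e (x i) (y i))
  represent-Eval-global x y le =
    let c , global = global-point
        e , c⊢e , eval = represent-Eval {J = 𝟙} (const c) (const ⋆) x y (⊢-proj₂ ⨾ le)
    in  e ⋆ , (global ⨾ c⊢e) , eval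

  -- If the tags coincide then A has a single element.
  Eval-fork⁻¹ : ∀ {a b x v} → Eval (p ff (p a b)) x v →
                Σ[ u ∈ A ] Σ[ w ∈ A ] Eval a x u × Eval b x w × Eval u w v
  Eval-fork⁻¹ {x = x} (fork {u = u} {w} eq d d′ d″) =
    let a≡ , b≡ = p-injective (proj₂ (p-injective eq))
    in  u , w , subst (λ c → Eval c x u) (sym a≡) d , subst (λ c → Eval c x w) (sym b≡) d′ , d″
  Eval-fork⁻¹ {a} {b} {x} {v} eval@(base eq _) =
    v , v , subst (λ c → Eval c x v) (all-equal _ a) eval , subst (λ c → Eval c x v) (all-equal _ b) eval ,
    subst₂ (λ c x → Eval c x v) (all-equal _ v) (all-equal x v) eval
    where
    all-equal : ∀ c d → c ≡ d
    all-equal c d = App-functional (App-tt c d) (subst (λ t → App t (p c d) d) (proj₁ (p-injective eq)) (App-ff c d))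

  -- The relative PCA.

  infixl 7 _·_
  _·_ : A → A → Maybe A
  a · x with em {Σ[ v ∈ A ] Eval a x v}
  ... | yes (v , _) = just v
  ... | no _        = nothing

  ·⇒Eval : ∀ {a x v} → a · x ≡ just v → Eval a x v
  ·⇒Eval {a} {x} eq with em {Σ[ v ∈ A ] Eval a x v}
  ·⇒Eval refl | yes (v , d) = d

  Eval⇒· : ∀ {a x v} → Eval a x v → a · x ≡ just v
  Eval⇒· {a} {x} d with em {Σ[ v ∈ A ] Eval a x v}
  ... | yes (_ , d′) = cong just (Eval-functional d′ d)
  ... | no undefined = ⊥-elim (undefined (_ , d))

  private
    -- Currying in two stages: `k₁` assigns to each `a`, and lets `a` track, a code of the constant
    -- function at `a`; `k₀` codes this assignment. For `s`, the inner function sends `b` to the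
    -- formal term.
    k₁ = represent-Eval {J = A} {I = A × A} id proj₁ proj₂ proj₁ ⊢-proj₁
    k₀ = represent-Eval-global id (proj₁ k₁) (proj₁ (proj₂ k₁))

    s₁ = represent-Eval {J = A} {I = A × A} id proj₁ proj₂ (λ (a , b) → p ff (p a b))
           (⊢-pair (≤-global (proj₁ (proj₂ F-rep))) ≤-refl)
    s₀ = represent-Eval-global id (proj₁ s₁) (proj₁ (proj₂ s₁))

    s₀-· : ∀ a → proj₁ s₀ · a ≡ just (proj₁ s₁ a)
    s₀-· a = Eval⇒· (proj₂ (proj₂ s₀) a)

    s₁-· : ∀ a b → proj₁ s₁ a · b ≡ just (p ff (p a b))
    s₁-· a b = Eval⇒· (proj₂ (proj₂ s₁) (a , b))

  ≡-Kleene : {m n : Maybe A} → (∀ v → m ≡ just v → n ≡ just v) → (∀ v → n ≡ just v → m ≡ just v) → m ≡ n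
  ≡-Kleene {just v} to from = sym (to v refl)
  ≡-Kleene {nothing} {just v} to from = from v refl
  ≡-Kleene {nothing} {nothing} to from = refl

  pca : RelativePCA ℓ
  pca = record
    { A = A ; _·_ = _·_ ; A# = A#
    ; closed = λ a∈ b∈ eq →
        let c , global = global-point
        in  decided (global ⨾ ⊢-Eval {f = const c} (λ _ → ·⇒Eval eq) (≤-global (holds a∈)) (≤-global (holds b∈)))
    ; k = proj₁ k₀
    ; s = proj₁ s₀
    ; k∈ = decided (proj₁ (proj₂ k₀))
    ; s∈ = decided (proj₁ (proj₂ s₀))
    ; k-law = k-law
    ; s-defined = λ a b → p ff (p a b) , s-app a b
    ; s-law = s-law
    }
    where
    infixl 7 _⊙_
    _⊙_ : Maybe A → Maybe A → Maybe A
    m ⊙ n = m >>= λ a → n >>= λ b → a · b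
    k-law : ∀ a b → just (proj₁ k₀) ⊙ just a ⊙ just b ≡ just a
    k-law a b = trans (cong (_⊙ just b) (Eval⇒· (proj₂ (proj₂ k₀) a))) (Eval⇒· (proj₂ (proj₂ k₁) (a , b)))
    s-app : ∀ a b → just (proj₁ s₀) ⊙ just a ⊙ just b ≡ just (p ff (p a b))
    s-app a b = trans (cong (_⊙ just b) (s₀-· a)) (s₁-· a b)
    -- Definedness passes from right to left by the constructor `fork` and from left to right by its
    -- inversion `Eval-fork⁻¹`.
    fork-law : ∀ a b c → p ff (p a b) · c ≡ (a · c) ⊙ (b · c)
    fork-law a b c = ≡-Kleene to from
      where
      to : ∀ v → p ff (p a b) · c ≡ just v → (a · c) ⊙ (b · c) ≡ just v
      to v eq =
        let u , w , d , d′ , d″ = Eval-fork⁻¹ (·⇒Eval eq)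
        in  trans (cong₂ _⊙_ (Eval⇒· d) (Eval⇒· d′)) (Eval⇒· d″)
      from : ∀ v → (a · c) ⊙ (b · c) ≡ just v → p ff (p a b) · c ≡ just v
      from v eq with a · c in ac | b · c in bc
      ... | just u | just w = Eval⇒· (fork refl (·⇒Eval ac) (·⇒Eval bc) (·⇒Eval eq))
    s-law : ∀ a b c → just (proj₁ s₀) ⊙ just a ⊙ just b ⊙ just c ≡ (just a ⊙ just c) ⊙ (just b ⊙ just c)
    s-law a b c = trans (cong (_⊙ just c) (s-app a b)) (fork-law a b c)

  -- Predicates as families of subsets.

  private
    module R = IndexedPreorder (realizabilityTripos pca)

  Elements : (I → 𝒫 A) → Set ℓ
  Elements {I} ψ = Σ[ i ∈ I ] Σ[ a ∈ A ] a ∈ ψ i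

  element : (ψ : I → 𝒫 A) → Elements ψ → A
  element ψ (_ , a , _) = a

  -- In the internal language: some `a` in `ψ i` satisfies `δ`.
  ⟦_⟧ : (I → 𝒫 A) → Pred I
  ⟦ ψ ⟧ = ∃[ proj₁ ] (element ψ ^* δ)

  ⟦⟧-mono : {φ ψ : I → 𝒫 A} → φ R.≤ ψ → ⟦ φ ⟧ ≤ ⟦ ψ ⟧
  ⟦⟧-mono {φ = φ} {ψ} (e , e∈ , real) =
    ∃-least proj₁ (⊢-Eval (λ x → ·⇒Eval (eq x)) (≤-global (holds e∈)) ≤-refl
      ⨾ proj₁ (^*-∘ t (element ψ) δ) ⨾ ^*-mono t (∃-unit proj₁ _) ⨾ proj₂ (^*-∘ t proj₁ _))
    where
    t : Elements φ → Elements ψ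
    t (i , a , a∈) = let b , _ , b∈ = real i a a∈ in i , b , b∈
    eq : ∀ x → e · element φ x ≡ just (element ψ (t x))
    eq (i , a , a∈) = proj₁ (proj₂ (real i a a∈))

  -- Primality lifts the projection of `Elements φ` to a map into `Elements ψ` over `I`. The chosen
  -- elements are tracked by the given ones, and a global code of this tracking is the realizer.
  ⟦⟧-reflect : {φ ψ : I → 𝒫 A} → ⟦ φ ⟧ ≤ ⟦ ψ ⟧ → φ R.≤ ψ
  ⟦⟧-reflect {φ = φ} {ψ} le =
    let t , t≗ , le′ = prime-lift (^*δ-prime (element φ)) proj₁ proj₁ (element ψ ^* δ) (∃-unit proj₁ _ ⨾ ^*-mono proj₁ le)
        e , global , eval = represent-Eval-global (element φ) (element ψ ∘ t) (le′ ⨾ proj₂ (^*-∘ t (element ψ) δ))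
    in  e , decided global , λ i a a∈ →
          let x = i , a , a∈
          in  element ψ (t x) , Eval⇒· (eval x) , subst (λ j → element ψ (t x) ∈ ψ j) (t≗ x) (proj₂ (proj₂ (t x)))

  ⟦⟧-natural : (u : I → J) (ψ : J → 𝒫 A) → ⟦ ψ ∘ u ⟧ ≅ u ^* ⟦ ψ ⟧
  ⟦⟧-natural {I} {J} u ψ = below , above
    where
    t : Elements (ψ ∘ u) → Elements ψ
    t (i , a,∈) = u i , a,∈
    below : ⟦ ψ ∘ u ⟧ ≤ u ^* ⟦ ψ ⟧
    below = ∃-least proj₁ (proj₁ (^*-∘ t (element ψ) δ) ⨾ ^*-mono t (∃-unit proj₁ _)
           ⨾ proj₂ (^*-∘ t proj₁ _) ⨾ proj₁ (^*-∘ proj₁ u _))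
    Z = Σ[ i ∈ I ] Σ[ x ∈ Elements ψ ] proj₁ x ≡ u i
    e : Z → Elements (ψ ∘ u)
    e (i , (_ , a , a∈) , eq) = i , a , subst (λ j → a ∈ ψ j) eq a∈
    above : u ^* ⟦ ψ ⟧ ≤ ⟦ ψ ∘ u ⟧
    above = proj₁ (∃-beckChevalley (canonicalPullback proj₁ u) _)
           ⨾ ∃-least proj₁ (proj₂ (^*-∘ (proj₁ ∘ proj₂) (element ψ) δ) ⨾ proj₁ (^*-∘ e (element (ψ ∘ u)) δ)
                ⨾ ^*-mono e (∃-unit proj₁ _) ⨾ proj₂ (^*-∘ e proj₁ _))

  realizers : Pred I → I → 𝒫 A
  realizers φ i a = let K , u , f , _ = presentation φ in ⌜ Σ[ k ∈ K ] (u k ≡ i) × (f k ≡ a) ⌝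

  -- Compared with the presenting set, `Elements` only merges indices with equal point and equal
  -- value. Maps in both directions preserve point and value, which gives the two inequalities.
  ⟦realizers⟧ : (φ : Pred I) → ⟦ realizers φ ⟧ ≅ φ
  ⟦realizers⟧ {I} φ = (∃-least proj₁ below ⨾ ≤φ) , (φ≤ ⨾ ∃-least u above)
    where
    pres = presentation φ
    u = proj₁ (proj₂ pres)
    f = proj₁ (proj₂ (proj₂ pres))
    φ≤ = proj₁ (proj₂ (proj₂ (proj₂ pres)))
    ≤φ = proj₂ (proj₂ (proj₂ (proj₂ pres)))
    origin : (x : Elements (realizers φ)) → Σ[ k ∈ proj₁ pres ] (u k ≡ proj₁ x) × (f k ≡ element (realizers φ) x)
    origin (_ , _ , x∈) = holds x∈
    pre : Elements (realizers φ) → proj₁ pres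
    pre = proj₁ ∘ origin
    below : element (realizers φ) ^* δ ≤ proj₁ ^* ∃[ u ] (f ^* δ)
    below = proj₁ (^*-cong (λ x → sym (proj₂ (proj₂ (origin x)))) δ) ⨾ proj₁ (^*-∘ pre f δ)
           ⨾ ^*-mono pre (∃-unit u _) ⨾ proj₂ (^*-∘ pre u _) ⨾ proj₁ (^*-cong (λ x → proj₁ (proj₂ (origin x))) _)
    into : proj₁ pres → Elements (realizers φ)
    into k = u k , f k , decided (k , refl , refl)
    above : f ^* δ ≤ u ^* ⟦ realizers φ ⟧
    above = proj₁ (^*-∘ into (element (realizers φ)) δ) ⨾ ^*-mono into (∃-unit proj₁ _) ⨾ proj₂ (^*-∘ into proj₁ _)

  -- Since `⟦_⟧` preserves and reflects the order and hits every predicate up to isomorphism, the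
  -- laws for `realizers` are checked after applying `⟦_⟧`.
  equivalence : P ≃ realizabilityTripos pca
  equivalence = record
    { forth = record
        { at      = realizers
        ; mono    = λ le → ⟦⟧-reflect (proj₁ (⟦realizers⟧ _) ⨾ le ⨾ proj₂ (⟦realizers⟧ _))
        ; natural = λ u φ →
            ⟦⟧-reflect (proj₁ (⟦realizers⟧ _) ⨾ ^*-mono u (proj₂ (⟦realizers⟧ φ)) ⨾ proj₂ (⟦⟧-natural u _)) ,
            ⟦⟧-reflect (proj₁ (⟦⟧-natural u _) ⨾ ^*-mono u (proj₁ (⟦realizers⟧ φ)) ⨾ proj₂ (⟦realizers⟧ _)) }
    ; back = record
        { at      = ⟦_⟧
        ; mono    = ⟦⟧-mono
        ; natural = ⟦⟧-natural }
    ; back∘forth = ⟦realizers⟧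
    ; forth∘back = λ ψ → ⟦⟧-reflect (proj₁ (⟦realizers⟧ _)) , ⟦⟧-reflect (proj₂ (⟦realizers⟧ _))
    }

theorem9p5 : {ℓ : Level} → ExcludedMiddle ℓ → (P : Tripos ℓ) →
    IsRelativeRealizability P ⇔ (HasEnoughPrimesᵀ P × HasFiniteMeets (primᵀ P) × HasDiscreteGeneric (primᵀ P))
theorem9p5 em P = mk⇔
  (λ (𝒜 , eqv) →
    let open FromPCA em indexedPreorder finiteMeets existential 𝒜 eqv
    in  enough , primeMeets , discreteGeneric)
  (λ (enough , primeMeets , discreteGeneric) →
    let open FromPrimes em indexedPreorder finiteMeets implication universal existential
               enough primeMeets discreteGeneric
    in  pca , equivalence)
  where
  open Tripos P using (indexedPreorder; finiteMeets; implication; universal)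
  open TriposExistential P using (existential)
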